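{- Let $n\geq 1$ be an integer which is divisible by $3$. Then \[\left\lfloor\sum_{i=1}^{10^n}\sqrt[3]{i}\right\rfloor=\frac{3\cdot 10^{4n/3}}{4}+5\cdot 10^{n/3-1}-1.\]
   Context: Here $\sqrt[3]{i}$ denotes the real cube root of $i$ and $\lfloor\cdot\rfloor$ is the floor function. -}

module Defs where

open import Data.Nat.Base as ℕ using (ℕ; zero; suc)
import Data.Nat.Properties as ℕ
open import Data.Nat.Tactic.RingSolver using (solve-∀)
open import Data.Integer.Base as ℤ using (ℤ; +_)
import Data.Integer.Properties as ℤ
open import Data.Rational.Base as ℚ using (ℚ; mkℚ; 0ℚ; 1ℚ; ½; ∣_∣; *<*; toℚᵘ; fromℚᵘ)
import Data.Rational.Properties as ℚ
open import Data.Rational.Solver using (module +-*-Solver)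
open import Data.Rational.Unnormalised.Base as ℚᵘ using (mkℚᵘ)
import Data.Rational.Unnormalised.Properties as ℚᵘ
open import Data.Product.Base using (_×_; _,_; proj₁; proj₂; ∃-syntax)
open import Data.Sum.Base using (_⊎_; inj₁; inj₂)
open import Relation.Nullary.Decidable using (Dec; yes; no)
open import Relation.Nullary.Negation using (contradiction)
open import Relation.Binary.PropositionalEquality

∣-∣< : ∀ {p q e} → p ℚ.- q ℚ.< e → q ℚ.- p ℚ.< e → ∣ p ℚ.- q ∣ ℚ.< e
∣-∣< {p} {q} {e} h₁ h₂ with ℚ.∣p∣≡p∨∣p∣≡-p (p ℚ.- q)
... | inj₁ eq = subst (ℚ._< e) (sym eq) h₁
... | inj₂ eq = subst (ℚ._< e)
  (trans (solve 2 (λ p q → q :- p := :- (p :- q)) refl p q) (sym eq)) h₂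
  where open +-*-Solver

half-pos : ∀ {e} → 0ℚ ℚ.< e → 0ℚ ℚ.< e ℚ.* ½
half-pos {e} h = ℚ.*-monoˡ-<-pos ½ h

halves : ∀ e → e ℚ.* ½ ℚ.+ e ℚ.* ½ ≡ e
halves e = trans (sym (ℚ.*-distribˡ-+ e ½ ½)) (ℚ.*-identityʳ e)

toℚᵘ-/ : ∀ a k → toℚᵘ (+ a ℚ./ suc k) ℚᵘ.≃ mkℚᵘ (+ a) k
toℚᵘ-/ a k = ℚ.toℚᵘ-fromℚᵘ (mkℚᵘ (+ a) k)

/-mono-< : ∀ {a b k l} → a ℕ.* suc l ℕ.< b ℕ.* suc k →
           + a ℚ./ suc k ℚ.< + b ℚ./ suc l
/-mono-< {a} {b} {k} {l} h = ℚ.toℚᵘ-cancel-< (ℚᵘ.<-respˡ-≃ (ℚᵘ.≃-sym (toℚᵘ-/ a k))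
  (ℚᵘ.<-respʳ-≃ (ℚᵘ.≃-sym (toℚᵘ-/ b l)) (ℚᵘ.*<* (subst₂ ℤ._<_
    (ℤ.pos-* a (suc l)) (ℤ.pos-* b (suc k)) (ℤ.+<+ h)))))

/-mono-≤ : ∀ {a b k l} → a ℕ.* suc l ℕ.≤ b ℕ.* suc k →
           + a ℚ./ suc k ℚ.≤ + b ℚ./ suc l
/-mono-≤ {a} {b} {k} {l} h = ℚ.toℚᵘ-cancel-≤ (ℚᵘ.≤-respˡ-≃ (ℚᵘ.≃-sym (toℚᵘ-/ a k))
  (ℚᵘ.≤-respʳ-≃ (ℚᵘ.≃-sym (toℚᵘ-/ b l)) (ℚᵘ.*≤* (subst₂ ℤ._≤_
    (ℤ.pos-* a (suc l)) (ℤ.pos-* b (suc k)) (ℤ.+≤+ h)))))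

/-cong : ∀ {a b k l} → a ℕ.* suc l ≡ b ℕ.* suc k → + a ℚ./ suc k ≡ + b ℚ./ suc l
/-cong {a} {b} {k} {l} e = ℚ.≤-antisym
  (/-mono-≤ {a} {b} {k} {l} (ℕ.≤-reflexive e))
  (/-mono-≤ {b} {a} {l} {k} (ℕ.≤-reflexive (sym e)))

/-+ : ∀ a b k → + a ℚ./ suc k ℚ.+ + b ℚ./ suc k ≡ + (a ℕ.+ b) ℚ./ suc k
/-+ a b k = ℚ.toℚᵘ-injective (ℚᵘ.≃-trans (ℚ.toℚᵘ-homo-+ (+ a ℚ./ suc k) (+ b ℚ./ suc k))
  (ℚᵘ.≃-trans (ℚᵘ.+-cong (toℚᵘ-/ a k) (toℚᵘ-/ b k))
  (ℚᵘ.≃-trans (ℚᵘ.*≡* eq) (ℚᵘ.≃-sym (toℚᵘ-/ (a ℕ.+ b) k)))))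
  where
  K = + suc k
  eq : (+ a ℤ.* K ℤ.+ + b ℤ.* K) ℤ.* K ≡ + (a ℕ.+ b) ℤ.* (+ (suc k ℕ.* suc k))
  eq = begin
    (+ a ℤ.* K ℤ.+ + b ℤ.* K) ℤ.* K ≡⟨ cong (ℤ._* K) (sym (ℤ.*-distribʳ-+ K (+ a) (+ b))) ⟩
    (+ (a ℕ.+ b) ℤ.* K) ℤ.* K       ≡⟨ ℤ.*-assoc (+ (a ℕ.+ b)) K K ⟩
    + (a ℕ.+ b) ℤ.* (K ℤ.* K)       ≡⟨ cong (+ (a ℕ.+ b) ℤ.*_) (sym (ℤ.pos-* (suc k) (suc k))) ⟩
    + (a ℕ.+ b) ℤ.* (+ (suc k ℕ.* suc k)) ∎
    where open ≡-Reasoning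

/-* : ∀ a b k l → (+ a ℚ./ suc k) ℚ.* (+ b ℚ./ suc l) ≡ + (a ℕ.* b) ℚ./ (suc k ℕ.* suc l)
/-* a b k l = ℚ.toℚᵘ-injective (ℚᵘ.≃-trans (ℚ.toℚᵘ-homo-* (+ a ℚ./ suc k) (+ b ℚ./ suc l))
  (ℚᵘ.≃-trans (ℚᵘ.*-cong (toℚᵘ-/ a k) (toℚᵘ-/ b l))
  (ℚᵘ.≃-trans (ℚᵘ.*≡* (cong (ℤ._* (+ (suc k ℕ.* suc l))) (sym (ℤ.pos-* a b))))
              (ℚᵘ.≃-sym (toℚᵘ-/ (a ℕ.* b) (l ℕ.+ k ℕ.* suc l))))))

archimedean : ∀ b ε → 0ℚ ℚ.< ε → ∃[ N ] ∀ n → N ℕ.≤ n → + b ℚ./ suc n ℚ.< ε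
archimedean b (mkℚ (+ 0) d c) (*<* (ℤ.+<+ ()))
archimedean b (mkℚ ℤ.-[1+ p ] d c) (*<* ())
archimedean b ε@(mkℚ (+ suc p) d c) _ = b ℕ.* suc d , λ n N≤n →
  subst (+ b ℚ./ suc n ℚ.<_) (ℚ.fromℚᵘ-toℚᵘ ε)
    (/-mono-< {b} {suc p} {n} {d}
      (ℕ.≤-<-trans N≤n (ℕ.≤-trans (ℕ.n<1+n n) (ℕ.m≤n*m (suc n) (suc p)))))

IsCauchy : (ℕ → ℚ) → Set
IsCauchy s = ∀ ε → 0ℚ ℚ.< ε →
  ∃[ N ] ∀ m n → N ℕ.≤ m → N ℕ.≤ n → ∣ s m ℚ.- s n ∣ ℚ.< ε

-- A real number is a Cauchy sequence of rationals; _≃_ below is equality of reals.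
record ℝ : Set where
  constructor mkℝ
  field
    seq    : ℕ → ℚ
    cauchy : IsCauchy seq

open ℝ public

infix 4 _≃_ _≤_ _<_

_≃_ _≤_ _<_ : ℝ → ℝ → Set
x ≃ y = ∀ ε → 0ℚ ℚ.< ε → ∃[ N ] ∀ n → N ℕ.≤ n → ∣ seq x n ℚ.- seq y n ∣ ℚ.< ε
x ≤ y = ∀ ε → 0ℚ ℚ.< ε → ∃[ N ] ∀ n → N ℕ.≤ n → seq x n ℚ.≤ seq y n ℚ.+ ε
x < y = ∃[ ε ] 0ℚ ℚ.< ε × ∃[ N ] ∀ n → N ℕ.≤ n → seq x n ℚ.+ ε ℚ.≤ seq y n

fromℤ : ℤ → ℝ
fromℤ m = mkℝ (λ _ → m ℚ./ 1) λ ε 0<ε →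
  0 , λ _ _ _ _ → subst (ℚ._< ε) (sym (cong ∣_∣ (ℚ.+-inverseʳ (m ℚ./ 1)))) 0<ε

infixl 6 _+_
infixl 7 _*_

_+_ : ℝ → ℝ → ℝ
x + y = mkℝ (λ n → seq x n ℚ.+ seq y n) +-cauchy
  where
  +-cauchy : IsCauchy (λ n → seq x n ℚ.+ seq y n)
  +-cauchy ε 0<ε with cauchy x (ε ℚ.* ½) (half-pos 0<ε) | cauchy y (ε ℚ.* ½) (half-pos 0<ε)
  ... | M , hx | N , hy = M ℕ.⊔ N , λ m n hm hn →
    let a = seq x m; b = seq y m; c = seq x n; d = seq y n
        hx′ = hx m n (ℕ.≤-trans (ℕ.m≤m⊔n M N) hm) (ℕ.≤-trans (ℕ.m≤m⊔n M N) hn)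
        hy′ = hy m n (ℕ.≤-trans (ℕ.m≤n⊔m M N) hm) (ℕ.≤-trans (ℕ.m≤n⊔m M N) hn)
    in begin-strict
      ∣ (a ℚ.+ b) ℚ.- (c ℚ.+ d) ∣
        ≡⟨ cong ∣_∣ (solve 4 (λ a b c d → (a :+ b) :- (c :+ d) := (a :- c) :+ (b :- d)) refl a b c d) ⟩
      ∣ (a ℚ.- c) ℚ.+ (b ℚ.- d) ∣   ≤⟨ ℚ.∣p+q∣≤∣p∣+∣q∣ (a ℚ.- c) (b ℚ.- d) ⟩
      ∣ a ℚ.- c ∣ ℚ.+ ∣ b ℚ.- d ∣   <⟨ ℚ.+-mono-< hx′ hy′ ⟩
      ε ℚ.* ½ ℚ.+ ε ℚ.* ½           ≡⟨ halves ε ⟩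
      ε ∎
    where open ℚ.≤-Reasoning
          open +-*-Solver

eventuallyBounded : ∀ x → ∃[ B ] 0ℚ ℚ.< B × ∃[ N ] ∀ n → N ℕ.≤ n → ∣ seq x n ∣ ℚ.≤ B
eventuallyBounded x with cauchy x 1ℚ (ℚ.positive⁻¹ 1ℚ)
... | N , h = 1ℚ ℚ.+ ∣ seq x N ∣
            , ℚ.+-mono-<-≤ (ℚ.positive⁻¹ 1ℚ) (ℚ.0≤∣p∣ (seq x N))
            , N , λ n hn → let a = seq x n; b = seq x N in begin
    ∣ a ∣                    ≡⟨ cong ∣_∣ (solve 2 (λ a b → a := (a :- b) :+ b) refl a b) ⟩
    ∣ (a ℚ.- b) ℚ.+ b ∣      ≤⟨ ℚ.∣p+q∣≤∣p∣+∣q∣ (a ℚ.- b) b ⟩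
    ∣ a ℚ.- b ∣ ℚ.+ ∣ b ∣    ≤⟨ ℚ.+-monoˡ-≤ ∣ b ∣ (ℚ.<⇒≤ (h n N hn ℕ.≤-refl)) ⟩
    1ℚ ℚ.+ ∣ b ∣ ∎
  where open ℚ.≤-Reasoning
        open +-*-Solver

p≤p+q : ∀ p q → 0ℚ ℚ.< q → p ℚ.≤ p ℚ.+ q
p≤p+q p q 0<q = subst (ℚ._≤ p ℚ.+ q) (ℚ.+-identityʳ p) (ℚ.+-monoʳ-≤ p (ℚ.<⇒≤ 0<q))

p≤q+p : ∀ p q → 0ℚ ℚ.< q → p ℚ.≤ q ℚ.+ p
p≤q+p p q 0<q = subst (ℚ._≤ q ℚ.+ p) (ℚ.+-identityˡ p) (ℚ.+-monoˡ-≤ p (ℚ.<⇒≤ 0<q))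

EventuallyBoundedBy : ℝ → ℚ → Set
EventuallyBoundedBy x B = ∃[ N ] ∀ n → N ℕ.≤ n → ∣ seq x n ∣ ℚ.≤ B

weaken : ∀ x {A B} → A ℚ.≤ B → EventuallyBoundedBy x A → EventuallyBoundedBy x B
weaken x A≤B (N , h) = N , λ n hn → ℚ.≤-trans (h n hn) A≤B

commonBound : ∀ x y → ∃[ B ] 0ℚ ℚ.< B × EventuallyBoundedBy x B × EventuallyBoundedBy y B
commonBound x y = combine (eventuallyBounded x) (eventuallyBounded y)
  where
  combine : ∃[ A ] 0ℚ ℚ.< A × EventuallyBoundedBy x A →
            ∃[ B ] 0ℚ ℚ.< B × EventuallyBoundedBy y B →
            ∃[ C ] 0ℚ ℚ.< C × EventuallyBoundedBy x C × EventuallyBoundedBy y C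
  combine (A , 0<A , a) (B , 0<B , b) =
    A ℚ.+ B , ℚ.<-≤-trans 0<A (p≤p+q A B 0<B) ,
    weaken x (p≤p+q A B 0<B) a , weaken y (p≤q+p B A 0<A) b

divide : ∀ η B → 0ℚ ℚ.< η → 0ℚ ℚ.< B → ∃[ δ ] 0ℚ ℚ.< δ × B ℚ.* δ ≡ η
divide η B 0<η 0<B =
  η ℚ.* i ,
  subst (ℚ._< η ℚ.* i) (ℚ.*-zeroˡ i) (ℚ.*-monoˡ-<-pos i {{ℚ.1/pos⇒pos B {{ℚ.positive 0<B}}}} 0<η) ,
  trans (solve 3 (λ b e i → b :* (e :* i) := e :* (b :* i)) refl B η i)
    (trans (cong (η ℚ.*_) (ℚ.*-inverseʳ B {{B≢0}})) (ℚ.*-identityʳ η))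
  where
  open +-*-Solver
  B≢0 = ℚ.pos⇒nonZero B {{ℚ.positive 0<B}}
  i = (ℚ.1/ B) {{B≢0}}

∣*∣-< : ∀ {B δ} p q → 0ℚ ℚ.< B → ∣ p ∣ ℚ.≤ B → ∣ q ∣ ℚ.< δ → ∣ p ℚ.* q ∣ ℚ.< B ℚ.* δ
∣*∣-< {B} {δ} p q 0<B hp hq = begin-strict
  ∣ p ℚ.* q ∣      ≡⟨ ℚ.∣p*q∣≡∣p∣*∣q∣ p q ⟩
  ∣ p ∣ ℚ.* ∣ q ∣  ≤⟨ ℚ.*-monoʳ-≤-nonNeg ∣ q ∣ {{ℚ.∣-∣-nonNeg q}} hp ⟩
  B ℚ.* ∣ q ∣      <⟨ ℚ.*-monoʳ-<-pos B {{ℚ.positive 0<B}} hq ⟩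
  B ℚ.* δ ∎
  where open ℚ.≤-Reasoning

∣*-*∣-< : ∀ {B δ} a b c d → 0ℚ ℚ.< B → ∣ a ∣ ℚ.≤ B → ∣ d ∣ ℚ.≤ B →
          ∣ a ℚ.- c ∣ ℚ.< δ → ∣ b ℚ.- d ∣ ℚ.< δ →
          ∣ a ℚ.* b ℚ.- c ℚ.* d ∣ ℚ.< B ℚ.* δ ℚ.+ B ℚ.* δ
∣*-*∣-< {B} {δ} a b c d 0<B ha hd hac hbd = begin-strict
  ∣ a ℚ.* b ℚ.- c ℚ.* d ∣
    ≡⟨ cong ∣_∣ (solve 4 (λ a b c d → a :* b :- c :* d := a :* (b :- d) :+ d :* (a :- c)) refl a b c d) ⟩
  ∣ a ℚ.* (b ℚ.- d) ℚ.+ d ℚ.* (a ℚ.- c) ∣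
    ≤⟨ ℚ.∣p+q∣≤∣p∣+∣q∣ (a ℚ.* (b ℚ.- d)) (d ℚ.* (a ℚ.- c)) ⟩
  ∣ a ℚ.* (b ℚ.- d) ∣ ℚ.+ ∣ d ℚ.* (a ℚ.- c) ∣
    <⟨ ℚ.+-mono-< (∣*∣-< a (b ℚ.- d) 0<B ha hbd) (∣*∣-< d (a ℚ.- c) 0<B hd hac) ⟩
  B ℚ.* δ ℚ.+ B ℚ.* δ ∎
  where open ℚ.≤-Reasoning
        open +-*-Solver

_*_ : ℝ → ℝ → ℝ
x * y = mkℝ (λ n → seq x n ℚ.* seq y n) *-cauchy
  where
  *-cauchy : IsCauchy (λ n → seq x n ℚ.* seq y n)
  *-cauchy ε 0<ε =
    let B , 0<B , (K , bx) , (L , by) = commonBound x y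
        δ , 0<δ , Bδ≡ε/2 = divide (ε ℚ.* ½) B (half-pos 0<ε) 0<B
        M , hx = cauchy x δ 0<δ
        N , hy = cauchy y δ 0<δ
    in (K ℕ.⊔ L) ℕ.⊔ (M ℕ.⊔ N) , λ m n hm hn →
    let hKLm = ℕ.m⊔n≤o⇒m≤o (K ℕ.⊔ L) (M ℕ.⊔ N) hm
        hMNm = ℕ.m⊔n≤o⇒n≤o (K ℕ.⊔ L) (M ℕ.⊔ N) hm
        hKLn = ℕ.m⊔n≤o⇒m≤o (K ℕ.⊔ L) (M ℕ.⊔ N) hn
        hMNn = ℕ.m⊔n≤o⇒n≤o (K ℕ.⊔ L) (M ℕ.⊔ N) hn
    in subst (∣ seq x m ℚ.* seq y m ℚ.- seq x n ℚ.* seq y n ∣ ℚ.<_)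
      (trans (cong₂ ℚ._+_ Bδ≡ε/2 Bδ≡ε/2) (halves ε))
      (∣*-*∣-< (seq x m) (seq y m) (seq x n) (seq y n) 0<B
        (bx m (ℕ.m⊔n≤o⇒m≤o K L hKLm)) (by n (ℕ.m⊔n≤o⇒n≤o K L hKLn))
        (hx m n (ℕ.m⊔n≤o⇒m≤o M N hMNm) (ℕ.m⊔n≤o⇒m≤o M N hMNn))
        (hy m n (ℕ.m⊔n≤o⇒n≤o M N hMNm) (ℕ.m⊔n≤o⇒n≤o M N hMNn)))

cube : ℕ → ℕ
cube a = a ℕ.* a ℕ.* a

cube-mono-≤ : ∀ {a b} → a ℕ.≤ b → cube a ℕ.≤ cube b
cube-mono-≤ h = ℕ.*-mono-≤ (ℕ.*-mono-≤ h h) h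

cube-cancel-< : ∀ {a b} → cube a ℕ.< cube b → a ℕ.< b
cube-cancel-< {a} {b} h with a ℕ.<? b
... | yes p = p
... | no ¬p = contradiction (cube-mono-≤ (ℕ.≮⇒≥ ¬p)) (ℕ.<⇒≱ h)

cube-* : ∀ a b → cube (a ℕ.* b) ≡ cube a ℕ.* cube b
cube-* = lemma
  where
  lemma : ∀ a b → a ℕ.* b ℕ.* (a ℕ.* b) ℕ.* (a ℕ.* b) ≡ a ℕ.* a ℕ.* a ℕ.* (b ℕ.* b ℕ.* b)
  lemma = solve-∀

⌊∛_⌋ : ℕ → ℕ
⌊∛ zero ⌋ = 0
⌊∛ suc n ⌋ with suc ⌊∛ n ⌋ ℕ.* suc ⌊∛ n ⌋ ℕ.* suc ⌊∛ n ⌋ ℕ.≤? suc n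
... | yes _ = suc ⌊∛ n ⌋
... | no  _ = ⌊∛ n ⌋

⌊∛⌋-lower : ∀ n → ⌊∛ n ⌋ ℕ.* ⌊∛ n ⌋ ℕ.* ⌊∛ n ⌋ ℕ.≤ n
⌊∛⌋-lower zero = ℕ.z≤n
⌊∛⌋-lower (suc n) with suc ⌊∛ n ⌋ ℕ.* suc ⌊∛ n ⌋ ℕ.* suc ⌊∛ n ⌋ ℕ.≤? suc n
... | yes p = p
... | no  _ = ℕ.m≤n⇒m≤1+n (⌊∛⌋-lower n)

⌊∛⌋-upper : ∀ n → n ℕ.< suc ⌊∛ n ⌋ ℕ.* suc ⌊∛ n ⌋ ℕ.* suc ⌊∛ n ⌋
⌊∛⌋-upper zero = ℕ.s≤s ℕ.z≤n
⌊∛⌋-upper (suc n) with suc ⌊∛ n ⌋ ℕ.* suc ⌊∛ n ⌋ ℕ.* suc ⌊∛ n ⌋ ℕ.≤? suc n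
... | no ¬p = ℕ.≰⇒> ¬p
... | yes _ = ℕ.≤-<-trans (⌊∛⌋-upper n) (cube-suc-< (suc ⌊∛ n ⌋))
  where
  cube-suc-< : ∀ a → cube a ℕ.< cube (suc a)
  cube-suc-< a = subst (cube a ℕ.<_) (sym (expand a)) (ℕ.m<m+n (cube a) (ℕ.s≤s ℕ.z≤n))
    where
    expand : ∀ a → (1 ℕ.+ a) ℕ.* (1 ℕ.+ a) ℕ.* (1 ℕ.+ a)
                 ≡ a ℕ.* a ℕ.* a ℕ.+ (1 ℕ.+ (3 ℕ.* a ℕ.+ 3 ℕ.* (a ℕ.* a)))
    expand = solve-∀

-- The n-th term is the largest multiple of 1/K whose cube is at most i, where K = n + 1.
-- That this represents the real cube root of i is ∛-cube and ∛-unique.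
∛-seq : ℕ → ℕ → ℚ
∛-seq i n = + ⌊∛ i ℕ.* (suc n ℕ.* suc n ℕ.* suc n) ⌋ ℚ./ suc n

∛-num : ℕ → ℕ → ℕ
∛-num i n = ⌊∛ i ℕ.* cube (suc n) ⌋

cross-< : ∀ i m n → ∛-num i m ℕ.* suc n ℕ.< suc (∛-num i n) ℕ.* suc m
cross-< i m n = cube-cancel-< (begin-strict
  cube (a ℕ.* N)              ≡⟨ cube-* a N ⟩
  cube a ℕ.* cube N           ≤⟨ ℕ.*-monoˡ-≤ (cube N) (⌊∛⌋-lower (i ℕ.* cube M)) ⟩
  i ℕ.* cube M ℕ.* cube N     ≡⟨ swap i (cube M) (cube N) ⟩
  i ℕ.* cube N ℕ.* cube M     <⟨ ℕ.*-monoˡ-< (cube M) (⌊∛⌋-upper (i ℕ.* cube N)) ⟩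
  cube b ℕ.* cube M           ≡⟨ sym (cube-* b M) ⟩
  cube (b ℕ.* M) ∎)
  where
  open ℕ.≤-Reasoning
  M = suc m
  N = suc n
  a = ∛-num i m
  b = suc (∛-num i n)
  swap : ∀ x y z → x ℕ.* y ℕ.* z ≡ x ℕ.* z ℕ.* y
  swap = solve-∀

∛-seq-gap : ∀ i m n → ∛-seq i m ℚ.- ∛-seq i n ℚ.< + 1 ℚ./ suc n
∛-seq-gap i m n = subst (p ℚ.- q ℚ.<_)
  (solve 2 (λ q r → (q :+ r) :- q := r) refl q (+ 1 ℚ./ suc n))
  (ℚ.+-monoˡ-< (ℚ.- q) (subst (p ℚ.<_)
    (trans (cong (λ t → + t ℚ./ suc n) (ℕ.+-comm 1 (∛-num i n))) (sym (/-+ (∛-num i n) 1 n)))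
    (/-mono-< {∛-num i m} {suc (∛-num i n)} {m} {n} (cross-< i m n))))
  where
  open +-*-Solver
  p = ∛-seq i m
  q = ∛-seq i n

∛ : ℕ → ℝ
∛ i = mkℝ (∛-seq i) λ ε 0<ε →
  let N , h = archimedean 1 ε 0<ε in
  N , λ m n hm hn → ∣-∣< {∛-seq i m} {∛-seq i n}
    (ℚ.<-trans (∛-seq-gap i m n) (h n hn))
    (ℚ.<-trans (∛-seq-gap i n m) (h m hm))

num-≤ : ∀ i n → ∛-num i n ℕ.≤ i ℕ.* suc n
num-≤ i n = ℕ.≤-pred (cube-cancel-< (begin-strict
  cube (∛-num i n)          ≤⟨ ⌊∛⌋-lower (i ℕ.* cube (suc n)) ⟩
  i ℕ.* cube (suc n)        ≤⟨ ℕ.*-monoˡ-≤ (cube (suc n)) (≤-cube i) ⟩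
  cube i ℕ.* cube (suc n)   ≡⟨ sym (cube-* i (suc n)) ⟩
  cube (i ℕ.* suc n)        <⟨ lt (i ℕ.* suc n) ⟩
  cube (suc (i ℕ.* suc n)) ∎))
  where
  open ℕ.≤-Reasoning
  ≤-cube : ∀ j → j ℕ.≤ cube j
  ≤-cube zero    = ℕ.z≤n
  ≤-cube (suc j) = ℕ.m≤n*m (suc j) (suc j ℕ.* suc j)
  lt : ∀ a → cube a ℕ.< cube (suc a)
  lt a = ℕ.*-mono-< (ℕ.*-mono-< (ℕ.n<1+n a) (ℕ.n<1+n a)) (ℕ.n<1+n a)

∛-defect : ∀ i n → ∃[ e ] (cube (∛-num i n) ℕ.+ e ≡ i ℕ.* cube (suc n)
                          × e ℕ.≤ 3 ℕ.* (suc i ℕ.* suc i) ℕ.* (suc n ℕ.* suc n))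
∛-defect i n = i ℕ.* cube K ℕ.∸ cube a , ℕ.m+[n∸m]≡n (⌊∛⌋-lower (i ℕ.* cube K)) , (begin
  i ℕ.* cube K ℕ.∸ cube a                     ≤⟨ ℕ.∸-monoˡ-≤ (cube a) (ℕ.<⇒≤ (⌊∛⌋-upper (i ℕ.* cube K))) ⟩
  cube (suc a) ℕ.∸ cube a                     ≡⟨ cong (ℕ._∸ cube a) (expand a) ⟩
  cube a ℕ.+ d ℕ.∸ cube a                     ≡⟨ ℕ.m+n∸m≡n (cube a) d ⟩
  d                                           ≤⟨ ℕ.m≤m+n d (2 ℕ.+ 3 ℕ.* a) ⟩
  d ℕ.+ (2 ℕ.+ 3 ℕ.* a)                       ≡⟨ square a ⟩
  3 ℕ.* (suc a ℕ.* suc a)                     ≤⟨ ℕ.*-monoʳ-≤ 3 (ℕ.*-mono-≤ a<iK a<iK) ⟩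
  3 ℕ.* (suc i ℕ.* K ℕ.* (suc i ℕ.* K))       ≡⟨ regroup (suc i) K ⟩
  3 ℕ.* (suc i ℕ.* suc i) ℕ.* (K ℕ.* K) ∎)
  where
  open ℕ.≤-Reasoning
  K = suc n
  a = ∛-num i n
  d = 1 ℕ.+ (3 ℕ.* a ℕ.+ 3 ℕ.* (a ℕ.* a))
  a<iK : suc a ℕ.≤ suc i ℕ.* K
  a<iK = ℕ.+-mono-≤ (ℕ.s≤s (ℕ.z≤n {n})) (num-≤ i n)
  expand : ∀ a → (1 ℕ.+ a) ℕ.* (1 ℕ.+ a) ℕ.* (1 ℕ.+ a)
               ≡ a ℕ.* a ℕ.* a ℕ.+ (1 ℕ.+ (3 ℕ.* a ℕ.+ 3 ℕ.* (a ℕ.* a)))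
  expand = solve-∀
  square : ∀ a → 1 ℕ.+ (3 ℕ.* a ℕ.+ 3 ℕ.* (a ℕ.* a)) ℕ.+ (2 ℕ.+ 3 ℕ.* a)
               ≡ 3 ℕ.* ((1 ℕ.+ a) ℕ.* (1 ℕ.+ a))
  square = solve-∀
  regroup : ∀ x y → 3 ℕ.* (x ℕ.* y ℕ.* (x ℕ.* y)) ≡ 3 ℕ.* (x ℕ.* x) ℕ.* (y ℕ.* y)
  regroup = solve-∀

cube-close : ∀ i n e → cube (∛-num i n) ℕ.+ e ≡ i ℕ.* cube (suc n) →
  e ℕ.≤ 3 ℕ.* (suc i ℕ.* suc i) ℕ.* (suc n ℕ.* suc n) →
  ∣ ∛-seq i n ℚ.* ∛-seq i n ℚ.* ∛-seq i n ℚ.- + i ℚ./ 1 ∣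
    ℚ.≤ + (3 ℕ.* (suc i ℕ.* suc i)) ℚ./ suc n
cube-close i n e eq e≤ = begin
  ∣ x³ ℚ.- + i ℚ./ 1 ∣     ≡⟨ cong (λ t → ∣ x³ ℚ.- t ∣) (sym x³+q≡i) ⟩
  ∣ x³ ℚ.- (x³ ℚ.+ q) ∣    ≡⟨ cong ∣_∣ (x-[x+q] x³ q) ⟩
  ∣ ℚ.- q ∣                ≡⟨ ℚ.∣-p∣≡∣p∣ q ⟩
  ∣ q ∣                    ≡⟨ ℚ.0≤p⇒∣p∣≡p (/-mono-≤ {0} {e} {0} {k³} ℕ.z≤n) ⟩
  q                        ≤⟨ /-mono-≤ {e} {C} {k³} {n} e*K≤ ⟩
  + C ℚ./ K ∎
  where
  open ℚ.≤-Reasoning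
  x-[x+q] : ∀ x q → x ℚ.- (x ℚ.+ q) ≡ ℚ.- q
  x-[x+q] = solve 2 (λ x q → x :- (x :+ q) := :- q) refl
    where open +-*-Solver
  K = suc n
  C = 3 ℕ.* (suc i ℕ.* suc i)
  a = ∛-num i n
  k³ = ℕ.pred (cube K)
  x³ = ∛-seq i n ℚ.* ∛-seq i n ℚ.* ∛-seq i n
  q = + e ℚ./ cube K
  e*K≤ : e ℕ.* K ℕ.≤ C ℕ.* cube K
  e*K≤ = ℕ.≤-trans (ℕ.*-monoˡ-≤ K e≤) (ℕ.≤-reflexive (ℕ.*-assoc C (K ℕ.* K) K))
  x³≡ : x³ ≡ + cube a ℚ./ cube K
  x³≡ = trans (cong (ℚ._* ∛-seq i n) (/-* a a n n)) (/-* (a ℕ.* a) a (ℕ.pred (K ℕ.* K)) n)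
  x³+q≡i : x³ ℚ.+ q ≡ + i ℚ./ 1
  x³+q≡i = trans (cong (ℚ._+ q) x³≡) (trans (/-+ (cube a) e k³)
    (/-cong {cube a ℕ.+ e} {i} {k³} {0} (trans (ℕ.*-identityʳ _) eq)))

∛-cube : ∀ i → ∛ i * ∛ i * ∛ i ≃ fromℤ (+ i)
∛-cube i ε 0<ε =
  let N , h = archimedean (3 ℕ.* (suc i ℕ.* suc i)) ε 0<ε in
  N , λ n hn → let e , eq , e≤ = ∛-defect i n in
  ℚ.≤-<-trans (cube-close i n e eq e≤) (h n hn)

p≤∣p∣ : ∀ p → p ℚ.≤ ∣ p ∣
p≤∣p∣ p with ℚ.≤-total 0ℚ p
... | inj₁ 0≤p = ℚ.≤-reflexive (sym (ℚ.0≤p⇒∣p∣≡p 0≤p))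
... | inj₂ p≤0 = ℚ.≤-trans p≤0 (ℚ.0≤∣p∣ p)

square-nonNeg : ∀ p → ℚ.NonNegative (p ℚ.* p)
square-nonNeg p with ℚ.≤-total 0ℚ p
... | inj₁ 0≤p = ℚ.nonNeg*nonNeg⇒nonNeg p {{ℚ.nonNegative 0≤p}} p {{ℚ.nonNegative 0≤p}}
... | inj₂ p≤0 = ℚ.nonPos*nonPos⇒nonPos p {{ℚ.nonPositive p≤0}} p {{ℚ.nonPositive p≤0}}

cubeℚ-mono-≤ : ∀ p q → 0ℚ ℚ.≤ p → p ℚ.≤ q → p ℚ.* p ℚ.* p ℚ.≤ q ℚ.* q ℚ.* q
cubeℚ-mono-≤ p q 0≤p p≤q = begin
  p ℚ.* p ℚ.* p  ≤⟨ ℚ.*-monoˡ-≤-nonNeg (p ℚ.* p) {{square-nonNeg p}} p≤q ⟩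
  p ℚ.* p ℚ.* q  ≤⟨ ℚ.*-monoʳ-≤-nonNeg q {{0≤q}} (ℚ.*-monoʳ-≤-nonNeg p {{ℚ.nonNegative 0≤p}} p≤q) ⟩
  q ℚ.* p ℚ.* q  ≤⟨ ℚ.*-monoʳ-≤-nonNeg q {{0≤q}} (ℚ.*-monoˡ-≤-nonNeg q {{0≤q}} p≤q) ⟩
  q ℚ.* q ℚ.* q ∎
  where
  open ℚ.≤-Reasoning
  0≤q = ℚ.nonNegative (ℚ.≤-trans 0≤p p≤q)

cube-gap : ∀ p q → 0ℚ ℚ.≤ p ℚ.- q →
  (p ℚ.- q) ℚ.* (p ℚ.- q) ℚ.* (p ℚ.- q) ℚ.≤
  let g = p ℚ.* p ℚ.* p ℚ.- q ℚ.* q ℚ.* q in (g ℚ.+ g) ℚ.+ (g ℚ.+ g)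
cube-gap p q 0≤d = subst (d³ ℚ.≤_) (identity p q)
  (subst (ℚ._≤ d³ ℚ.+ ((r ℚ.+ r) ℚ.+ r)) (ℚ.+-identityʳ d³)
    (ℚ.+-monoʳ-≤ d³ (ℚ.nonNegative⁻¹ ((r ℚ.+ r) ℚ.+ r) {{3r}})))
  where
  d = p ℚ.- q
  s = p ℚ.+ q
  d³ = d ℚ.* d ℚ.* d
  r = d ℚ.* (s ℚ.* s)
  r≥0 : ℚ.NonNegative r
  r≥0 = ℚ.nonNeg*nonNeg⇒nonNeg d {{ℚ.nonNegative 0≤d}} (s ℚ.* s) {{square-nonNeg s}}
  2r = ℚ.nonNeg+nonNeg⇒nonNeg r {{r≥0}} r {{r≥0}}
  3r = ℚ.nonNeg+nonNeg⇒nonNeg (r ℚ.+ r) {{2r}} r {{r≥0}}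
  identity : ∀ p q →
    let d = p ℚ.- q; s = p ℚ.+ q; r = d ℚ.* (s ℚ.* s); g = p ℚ.* p ℚ.* p ℚ.- q ℚ.* q ℚ.* q in
    d ℚ.* d ℚ.* d ℚ.+ ((r ℚ.+ r) ℚ.+ r) ≡ (g ℚ.+ g) ℚ.+ (g ℚ.+ g)
  identity = solve 2 (λ p q →
    let d = p :- q; s = p :+ q; r = d :* (s :* s); g = p :* p :* p :- q :* q :* q in
    d :* d :* d :+ ((r :+ r) :+ r) := (g :+ g) :+ (g :+ g)) refl
    where open +-*-Solver

cube-close⇒< : ∀ p q c ε → 0ℚ ℚ.< ε → let η = ε ℚ.* ε ℚ.* ε ℚ.* ½ ℚ.* ½ ℚ.* ½ in
  ∣ p ℚ.* p ℚ.* p ℚ.- c ∣ ℚ.< η → ∣ q ℚ.* q ℚ.* q ℚ.- c ∣ ℚ.< η → p ℚ.- q ℚ.< ε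
cube-close⇒< p q c ε 0<ε hp hq with p ℚ.- q ℚ.<? ε
... | yes h = h
... | no ¬h = contradiction (ℚ.≤-<-trans ε³≤4g 4g<ε³) (ℚ.<-irrefl refl)
  where
  ε³ = ε ℚ.* ε ℚ.* ε
  η = ε³ ℚ.* ½ ℚ.* ½ ℚ.* ½
  p³ = p ℚ.* p ℚ.* p
  q³ = q ℚ.* q ℚ.* q
  g = p³ ℚ.- q³
  ε≤d = ℚ.≮⇒≥ ¬h
  ε³≤4g : ε³ ℚ.≤ (g ℚ.+ g) ℚ.+ (g ℚ.+ g)
  ε³≤4g = ℚ.≤-trans (cubeℚ-mono-≤ ε (p ℚ.- q) (ℚ.<⇒≤ 0<ε) ε≤d)
                    (cube-gap p q (ℚ.≤-trans (ℚ.<⇒≤ 0<ε) ε≤d))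
  split : ∀ x y c → (x ℚ.- c) ℚ.+ (ℚ.- (y ℚ.- c)) ≡ x ℚ.- y
  split = solve 3 (λ x y c → (x :- c) :+ (:- (y :- c)) := x :- y) refl
    where open +-*-Solver
  g<2η : g ℚ.< ε³ ℚ.* ½ ℚ.* ½
  g<2η = subst₂ ℚ._<_ (split p³ q³ c) (halves (ε³ ℚ.* ½ ℚ.* ½))
    (ℚ.+-mono-< (ℚ.≤-<-trans (p≤∣p∣ (p³ ℚ.- c)) hp)
      (ℚ.≤-<-trans (p≤∣p∣ (ℚ.- (q³ ℚ.- c)))
        (subst (ℚ._< η) (sym (ℚ.∣-p∣≡∣p∣ (q³ ℚ.- c))) hq)))
  2g<4η : g ℚ.+ g ℚ.< ε³ ℚ.* ½
  2g<4η = subst (g ℚ.+ g ℚ.<_) (halves (ε³ ℚ.* ½)) (ℚ.+-mono-< g<2η g<2η)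
  4g<ε³ : (g ℚ.+ g) ℚ.+ (g ℚ.+ g) ℚ.< ε³
  4g<ε³ = subst ((g ℚ.+ g) ℚ.+ (g ℚ.+ g) ℚ.<_) (halves ε³) (ℚ.+-mono-< 2g<4η 2g<4η)

∛-unique : ∀ i x → x * x * x ≃ fromℤ (+ i) → x ≃ ∛ i
∛-unique i x x³≃i ε 0<ε =
  let 0<η = half-pos (half-pos (half-pos 0<ε³))
      M , hx = x³≃i η 0<η
      N , hr = ∛-cube i η 0<η
  in M ℕ.⊔ N , λ n hn →
    let hx′ = hx n (ℕ.m⊔n≤o⇒m≤o M N hn)
        hr′ = hr n (ℕ.m⊔n≤o⇒n≤o M N hn)
    in ∣-∣< {seq x n} {∛-seq i n}
         (cube-close⇒< (seq x n) (∛-seq i n) (+ i ℚ./ 1) ε 0<ε hx′ hr′)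
         (cube-close⇒< (∛-seq i n) (seq x n) (+ i ℚ./ 1) ε 0<ε hr′ hx′)
  where
  η = ε ℚ.* ε ℚ.* ε ℚ.* ½ ℚ.* ½ ℚ.* ½
  0<ε³ : 0ℚ ℚ.< ε ℚ.* ε ℚ.* ε
  0<ε³ = ℚ.positive⁻¹ (ε ℚ.* ε ℚ.* ε) {{ℚ.pos*pos⇒pos (ε ℚ.* ε) {{ℚ.pos*pos⇒pos ε {{+ε}} ε {{+ε}}}} ε {{+ε}}}}
    where +ε = ℚ.positive 0<ε

-- ∑₁ N f = f 1 + f 2 + ⋯ + f N
∑₁ : ℕ → (ℕ → ℝ) → ℝ
∑₁ zero    f = fromℤ (+ 0)
∑₁ (suc N) f = ∑₁ N f + f (suc N)

-- A relation, since no floor function on ℝ is constructively definable.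
infix 4 ⌊_⌋≡_
⌊_⌋≡_ : ℝ → ℤ → Set
⌊ x ⌋≡ m = fromℤ m ≤ x × x < fromℤ (m ℤ.+ + 1)

{-# OPTIONS --safe #-}

-- Write rᵢ = ∛i.  For a = rᵢ₊₁ and b = rᵢ the trapezoidal identity
--   3(a⁴ − b⁴) − 2(a + b)(a³ − b³) = (a − b)³(a + b)
-- and a³ − b³ = 1 show that 3rᵢ⁴ + 2rᵢ − 4(r₁ + ⋯ + rᵢ) increases with i; it is 1 at i = 1.
-- Its increment (a − b)³(a + b) is at most twice the preceding second difference
-- 2rᵢ − rᵢ₋₁ − rᵢ₊₁, so it increases by at most 2 altogether.  At i = M³ this gives
--   3M⁴ + 2M − 3 ≤ 4(r₁ + ⋯ + rᵢ) ≤ 3M⁴ + 2M − 1.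
-- The cube roots are only approximated by their rational representatives, so each
-- inequality is a polynomial one between rationals up to a sequence tending to 0.
module Submission where

open import Defs using (∛; ∑₁; ⌊_⌋≡_)
open import Data.Nat.Base using (ℕ; _≤_; _*_; _^_; _∸_) renaming (_/_ to _div_)
open import Data.Nat.Divisibility using (_∣_; divides)
open import Data.Integer.Base as ℤ using (ℤ; +_; -1ℤ)
open import Data.Rational.Base using (1ℚ; _/_; _+_; _-_)
open import Data.Product.Base using (∃-syntax; _×_; _,_)
open import Relation.Binary.PropositionalEquality using (_≡_; refl; sym; trans; cong; cong₂; subst; subst₂; module ≡-Reasoning)

import Defs as ℝ
open ℝ using (ℝ; seq; fromℤ; ∛-seq; ∛-num; ⌊∛_⌋; cube; _≃_)
open import Data.Nat.Base as ℕ using (zero; suc)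
import Data.Nat.DivMod as ℕ
import Data.Nat.Properties as ℕ
open import Data.Nat.Tactic.RingSolver using (solve-∀)
open import Data.Rational.Base as ℚ using (ℚ; 0ℚ; ½; ∣_∣)
import Data.Rational.Properties as ℚ
open import Data.Rational.Solver using (module +-*-Solver)
open +-*-Solver using (solve; _:+_; _:*_; _:-_; _:=_; con)

Null : (ℕ → ℚ) → Set
Null z = ∀ ε → 0ℚ ℚ.< ε → ∃[ N ] ∀ n → N ℕ.≤ n → ∣ z n ∣ ℚ.< ε

null-cong : ∀ {y z} → (∀ n → y n ≡ z n) → Null y → Null z
null-cong y≡z null ε 0<ε =
  let N , h = null ε 0<ε in N , λ n hn → subst (λ t → ∣ t ∣ ℚ.< ε) (y≡z n) (h n hn)

null-+ : ∀ {y z} → Null y → Null z → Null (λ n → y n ℚ.+ z n)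
null-+ {y} {z} null-y null-z ε 0<ε =
  let M , hy = null-y (ε ℚ.* ½) (ℝ.half-pos 0<ε)
      N , hz = null-z (ε ℚ.* ½) (ℝ.half-pos 0<ε)
  in M ℕ.⊔ N , λ n hn →
    ℚ.≤-<-trans (ℚ.∣p+q∣≤∣p∣+∣q∣ (y n) (z n))
      (subst (∣ y n ∣ ℚ.+ ∣ z n ∣ ℚ.<_) (ℝ.halves ε)
        (ℚ.+-mono-< (hy n (ℕ.m⊔n≤o⇒m≤o M N hn)) (hz n (ℕ.m⊔n≤o⇒n≤o M N hn))))

null-* : ∀ x {z} → Null z → Null (λ n → seq x n ℚ.* z n)
null-* x {z} null-z ε 0<ε =
  let B , 0<B , M , hx = ℝ.eventuallyBounded x
      δ , 0<δ , Bδ≡ε = ℝ.divide ε B 0<ε 0<B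
      N , hz = null-z δ 0<δ
  in M ℕ.⊔ N , λ n hn →
    subst (∣ seq x n ℚ.* z n ∣ ℚ.<_) Bδ≡ε
      (ℝ.∣*∣-< (seq x n) (z n) 0<B (hx n (ℕ.m⊔n≤o⇒m≤o M N hn)) (hz n (ℕ.m⊔n≤o⇒n≤o M N hn)))

≤-up-to-null : ∀ x y {z} → Null z → (∀ n → seq x n ℚ.≤ seq y n ℚ.+ z n) → x ℝ.≤ y
≤-up-to-null x y {z} null-z h ε 0<ε =
  let N , hz = null-z ε 0<ε in N , λ n hn →
  ℚ.≤-trans (h n) (ℚ.+-monoʳ-≤ (seq y n)
    (ℚ.≤-trans (ℝ.p≤∣p∣ (z n)) (ℚ.<⇒≤ (hz n hn))))

≤-trans : ∀ x y z → x ℝ.≤ y → y ℝ.≤ z → x ℝ.≤ z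
≤-trans x y z x≤y y≤z ε 0<ε =
  let M , h = x≤y (ε ℚ.* ½) (ℝ.half-pos 0<ε)
      N , k = y≤z (ε ℚ.* ½) (ℝ.half-pos 0<ε)
  in M ℕ.⊔ N , λ n hn → begin
    seq x n                                  ≤⟨ h n (ℕ.m⊔n≤o⇒m≤o M N hn) ⟩
    seq y n ℚ.+ ε ℚ.* ½                      ≤⟨ ℚ.+-monoˡ-≤ (ε ℚ.* ½) (k n (ℕ.m⊔n≤o⇒n≤o M N hn)) ⟩
    (seq z n ℚ.+ ε ℚ.* ½) ℚ.+ ε ℚ.* ½        ≡⟨ ℚ.+-assoc (seq z n) (ε ℚ.* ½) (ε ℚ.* ½) ⟩
    seq z n ℚ.+ (ε ℚ.* ½ ℚ.+ ε ℚ.* ½)        ≡⟨ cong (seq z n ℚ.+_) (ℝ.halves ε) ⟩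
    seq z n ℚ.+ ε ∎
  where open ℚ.≤-Reasoning

≤-pointwise : ∀ x y → (∀ n → seq x n ℚ.≤ seq y n) → x ℝ.≤ y
≤-pointwise x y h ε 0<ε = 0 , λ n _ → ℚ.≤-trans (h n) (ℝ.p≤p+q (seq y n) ε 0<ε)

+-monoˡ-≤ : ∀ x y z → x ℝ.≤ y → x ℝ.+ z ℝ.≤ y ℝ.+ z
+-monoˡ-≤ x y z x≤y ε 0<ε =
  let N , h = x≤y ε 0<ε in N , λ n hn →
  subst (seq x n ℚ.+ seq z n ℚ.≤_)
    (solve 3 (λ y e z → (y :+ e) :+ z := (y :+ z) :+ e) refl (seq y n) ε (seq z n))
    (ℚ.+-monoˡ-≤ (seq z n) (h n hn))

≃-pointwise : ∀ x y → (∀ n → seq x n ≡ seq y n) → x ≃ y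
≃-pointwise x y x≡y ε 0<ε = 0 , λ n _ → subst (λ t → ∣ t ∣ ℚ.< ε)
  (sym (trans (cong (ℚ._- seq y n) (x≡y n)) (ℚ.+-inverseʳ (seq y n)))) 0<ε

≃-sym : ∀ x y → x ≃ y → y ≃ x
≃-sym x y x≃y = null-cong
  (λ n → solve 2 (λ x y → con (ℚ.- 1ℚ) :* (x :- y) := y :- x) refl (seq x n) (seq y n))
  (null-* (fromℤ -1ℤ) x≃y)

≃⇒≤ : ∀ x y → x ≃ y → x ℝ.≤ y
≃⇒≤ x y x≃y = ≤-up-to-null x y x≃y λ n → ℚ.≤-reflexive
  (solve 2 (λ x y → x := y :+ (x :- y)) refl (seq x n) (seq y n))

⌊∛⌋-mono-≤ : ∀ {k l} → k ≤ l → ⌊∛ k ⌋ ≤ ⌊∛ l ⌋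
⌊∛⌋-mono-≤ {k} {l} k≤l = ℕ.≤-pred (ℝ.cube-cancel-<
  (ℕ.≤-<-trans (ℝ.⌊∛⌋-lower k) (ℕ.≤-<-trans k≤l (ℝ.⌊∛⌋-upper l))))

∛-seq-≤-suc : ∀ i n → ∛-seq i n ℚ.≤ ∛-seq (suc i) n
∛-seq-≤-suc i n = ℝ./-mono-≤ {∛-num i n} {∛-num (suc i) n} {n} {n} (ℕ.*-monoˡ-≤ (suc n)
  (⌊∛⌋-mono-≤ (ℕ.*-monoˡ-≤ (cube (suc n)) (ℕ.n≤1+n i))))

0≤∛-seq : ∀ i n → 0ℚ ℚ.≤ ∛-seq i n
0≤∛-seq i n = ℝ./-mono-≤ {0} {∛-num i n} {0} {n} ℕ.z≤n

∛-of-cube : ∀ m → ∛ (cube m) ≃ fromℤ (+ m)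
∛-of-cube m = ≃-sym k (∛ (cube m)) (ℝ.∛-unique (cube m) k
  (≃-pointwise (k ℝ.* k ℝ.* k) (fromℤ (+ cube m)) λ _ →
    trans (cong (ℚ._* (+ m / 1)) (ℝ./-* m m 0 0)) (ℝ./-* (m * m) m 0 0)))
  where k = fromℤ (+ m)

cube-step : ℕ → ℕ → ℚ
cube-step i n = a ℚ.* a ℚ.* a ℚ.- b ℚ.* b ℚ.* b ℚ.- 1ℚ
  where
  a = ∛-seq (suc i) n
  b = ∛-seq i n

null-cube-step : ∀ i → Null (cube-step i)
null-cube-step i = null-cong pointwise
  (null-+ (ℝ.∛-cube (suc i)) (null-* (fromℤ -1ℤ) (ℝ.∛-cube i)))
  where
  pointwise : ∀ n → let a = ∛-seq (suc i) n; b = ∛-seq i n in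
    (a ℚ.* a ℚ.* a ℚ.- + suc i / 1) ℚ.+ ℚ.- 1ℚ ℚ.* (b ℚ.* b ℚ.* b ℚ.- + i / 1) ≡ cube-step i n
  pointwise n = trans
    (cong (λ t → (a³ ℚ.- t) ℚ.+ ℚ.- 1ℚ ℚ.* (b³ ℚ.- + i / 1)) (sym (ℝ./-+ 1 i 0)))
    (solve 3 (λ a³ b³ k → (a³ :- (con 1ℚ :+ k)) :+ con (ℚ.- 1ℚ) :* (b³ :- k) := a³ :- b³ :- con 1ℚ)
      refl a³ b³ (+ i / 1))
    where
    a = ∛-seq (suc i) n
    b = ∛-seq i n
    a³ = a ℚ.* a ℚ.* a
    b³ = b ℚ.* b ℚ.* b

0≤+ : ∀ {p q} → 0ℚ ℚ.≤ p → 0ℚ ℚ.≤ q → 0ℚ ℚ.≤ p ℚ.+ q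
0≤+ = ℚ.+-mono-≤

0≤* : ∀ {p q} → 0ℚ ℚ.≤ p → 0ℚ ℚ.≤ q → 0ℚ ℚ.≤ p ℚ.* q
0≤* {p} {q} 0≤p 0≤q = ℚ.nonNegative⁻¹ (p ℚ.* q)
  {{ℚ.nonNeg*nonNeg⇒nonNeg p {{ℚ.nonNegative 0≤p}} q {{ℚ.nonNegative 0≤q}}}}

≤-from-remainder : ∀ {p q r} → 0ℚ ℚ.≤ r → q ≡ p ℚ.+ r → p ℚ.≤ q
≤-from-remainder {p} {q} {r} 0≤r q≡p+r = subst₂ ℚ._≤_ (ℚ.+-identityʳ p) (sym q≡p+r) (ℚ.+-monoʳ-≤ p 0≤r)

0≤- : ∀ {p q} → p ℚ.≤ q → 0ℚ ℚ.≤ q ℚ.- p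
0≤- {p} {q} p≤q = subst (ℚ._≤ q ℚ.- p) (ℚ.+-inverseʳ p) (ℚ.+-monoˡ-≤ (ℚ.- p) p≤q)

2ℚ 3ℚ 4ℚ : ℚ
2ℚ = + 2 / 1
3ℚ = + 3 / 1
4ℚ = + 4 / 1

2ℝ 3ℝ 4ℝ : ℝ
2ℝ = fromℤ (+ 2)
3ℝ = fromℤ (+ 3)
4ℝ = fromℤ (+ 4)

infixl 6 _−_
_−_ : ℝ → ℝ → ℝ
x − y = x ℝ.+ fromℤ -1ℤ ℝ.* y

quartic : ℝ → ℝ
quartic x = 3ℝ ℝ.* (x ℝ.* x ℝ.* x ℝ.* x) ℝ.+ 2ℝ ℝ.* x

quartic-cong : ∀ x y → x ≃ y → quartic x ≃ quartic y
quartic-cong x y x≃y = null-cong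
  (λ n → solve 2 (λ x y →
    (con 3ℚ :* ((x :+ y) :* (x :* x :+ y :* y)) :+ con 2ℚ) :* (x :- y) :=
    (con 3ℚ :* (x :* x :* x :* x) :+ con 2ℚ :* x) :- (con 3ℚ :* (y :* y :* y :* y) :+ con 2ℚ :* y))
    refl (seq x n) (seq y n))
  (null-* (3ℝ ℝ.* ((x ℝ.+ y) ℝ.* (x ℝ.* x ℝ.+ y ℝ.* y)) ℝ.+ 2ℝ) x≃y)

quartic-fromℤ : ∀ m n → seq (quartic (fromℤ (+ m))) n ≡ + (3 * (cube m * m) ℕ.+ 2 * m) / 1
quartic-fromℤ m _ = trans
  (cong₂ ℚ._+_
    (trans (cong (3ℚ ℚ.*_) (trans (cong (λ t → t ℚ.* (+ m / 1) ℚ.* (+ m / 1)) (ℝ./-* m m 0 0))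
      (trans (cong (ℚ._* (+ m / 1)) (ℝ./-* (m * m) m 0 0)) (ℝ./-* (cube m) m 0 0))))
      (ℝ./-* 3 (cube m * m) 0 0))
    (ℝ./-* 2 m 0 0))
  (ℝ./-+ (3 * (cube m * m)) (2 * m) 0)

∛1≃1 : ∛ 1 ≃ fromℤ (+ 1)
∛1≃1 = ∛-of-cube 1

4∑+1≤quartic : ∀ i → 4ℝ ℝ.* ∑₁ (suc i) ∛ ℝ.+ fromℤ (+ 1) ℝ.≤ quartic (∛ (suc i))
4∑+1≤quartic zero = ≤-up-to-null (4ℝ ℝ.* ∑₁ 1 ∛ ℝ.+ fromℤ (+ 1)) (quartic r)
  (null-* (fromℤ -1ℤ ℝ.* (3ℝ ℝ.* (r ℝ.* r ℝ.* r ℝ.+ r ℝ.* r ℝ.+ r) ℝ.+ fromℤ (+ 1))) ∛1≃1)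
  λ n → ℚ.≤-reflexive (solve 1 (λ r →
    con 4ℚ :* (con 0ℚ :+ r) :+ con 1ℚ :=
    (con 3ℚ :* (r :* r :* r :* r) :+ con 2ℚ :* r)
      :+ (con (ℚ.- 1ℚ) :* (con 3ℚ :* (r :* r :* r :+ r :* r :+ r) :+ con 1ℚ)) :* (r :- con 1ℚ))
    refl (seq r n))
  where r = ∛ 1
4∑+1≤quartic (suc i) ε 0<ε = let N , h = bound ε 0<ε in N , λ n hn →
    subst (ℚ._≤ seq (quartic a) n ℚ.+ ε)
      (solve 2 (λ s a → (con 4ℚ :* s :+ con 1ℚ) :+ con 4ℚ :* a := con 4ℚ :* (s :+ a) :+ con 1ℚ) refl
        (seq s n) (seq a n)) (h n hn)
  where
  s = ∑₁ (suc i) ∛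
  a = ∛ (suc (suc i))
  b = ∛ (suc i)
  step : quartic b ℝ.+ 4ℝ ℝ.* a ℝ.≤ quartic a
  step = ≤-up-to-null (quartic b ℝ.+ 4ℝ ℝ.* a) (quartic a)
    (null-* (fromℤ -1ℤ ℝ.* (2ℝ ℝ.* (a ℝ.+ b))) (null-cube-step (suc i)))
    λ n → ≤-from-remainder (remainder≥0 n) (solve 2 (λ a b →
      (con 3ℚ :* (a :* a :* a :* a) :+ con 2ℚ :* a)
        :+ (con (ℚ.- 1ℚ) :* (con 2ℚ :* (a :+ b))) :* (a :* a :* a :- b :* b :* b :- con 1ℚ) :=
      (con 3ℚ :* (b :* b :* b :* b) :+ con 2ℚ :* b) :+ con 4ℚ :* a
        :+ (a :- b) :* (a :- b) :* (a :- b) :* (a :+ b))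
      refl (seq a n) (seq b n))
    where
    remainder≥0 : ∀ n → let p = seq a n ℚ.- seq b n in 0ℚ ℚ.≤ p ℚ.* p ℚ.* p ℚ.* (seq a n ℚ.+ seq b n)
    remainder≥0 n = 0≤* (0≤* (0≤* 0≤p 0≤p) 0≤p) (0≤+ (0≤∛-seq (suc (suc i)) n) (0≤∛-seq (suc i) n))
      where 0≤p = 0≤- (∛-seq-≤-suc (suc i) n)
  bound : (4ℝ ℝ.* s ℝ.+ fromℤ (+ 1)) ℝ.+ 4ℝ ℝ.* a ℝ.≤ quartic a
  bound = ≤-trans ((4ℝ ℝ.* s ℝ.+ fromℤ (+ 1)) ℝ.+ 4ℝ ℝ.* a) (quartic b ℝ.+ 4ℝ ℝ.* a) (quartic a)
    (+-monoˡ-≤ (4ℝ ℝ.* s ℝ.+ fromℤ (+ 1)) (quartic b) (4ℝ ℝ.* a) (4∑+1≤quartic i)) step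

quartic+2Δ≤4∑+3 : ∀ i →
  quartic (∛ (suc i)) ℝ.+ 2ℝ ℝ.* (∛ (suc i) − ∛ i) ℝ.≤ 4ℝ ℝ.* ∑₁ (suc i) ∛ ℝ.+ 3ℝ
quartic+2Δ≤4∑+3 zero = ≤-up-to-null (quartic r ℝ.+ 2ℝ ℝ.* (r − ∛ 0)) (4ℝ ℝ.* ∑₁ 1 ∛ ℝ.+ 3ℝ)
  (null-* (3ℝ ℝ.* (r ℝ.* r ℝ.* r ℝ.+ r ℝ.* r ℝ.+ r ℝ.+ fromℤ (+ 1))) ∛1≃1)
  λ n → ≤-from-remainder (0≤* {2ℚ} (ℚ.nonNegative⁻¹ 2ℚ) (0≤∛-seq 0 n)) (solve 2 (λ r o →
    (con 4ℚ :* (con 0ℚ :+ r) :+ con 3ℚ)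
      :+ (con 3ℚ :* (r :* r :* r :+ r :* r :+ r :+ con 1ℚ)) :* (r :- con 1ℚ) :=
    ((con 3ℚ :* (r :* r :* r :* r) :+ con 2ℚ :* r) :+ con 2ℚ :* (r :+ con (ℚ.- 1ℚ) :* o))
      :+ con 2ℚ :* o)
    refl (seq r n) (seq (∛ 0) n))
  where r = ∛ 1
quartic+2Δ≤4∑+3 (suc i) ε 0<ε = let N , h = bound ε 0<ε in N , λ n hn →
    subst (λ t → seq x n ℚ.≤ t ℚ.+ ε)
      (solve 2 (λ s c → (con 4ℚ :* s :+ con 3ℚ) :+ con 4ℚ :* c := con 4ℚ :* (s :+ c) :+ con 3ℚ) refl
        (seq s n) (seq c n)) (h n hn)
  where
  s = ∑₁ (suc i) ∛
  c = ∛ (suc (suc i))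
  a = ∛ (suc i)
  b = ∛ i
  p = c − a
  q = a − b
  w = (c − b) ℝ.* (a ℝ.+ b ℝ.+ c)
  e = 2ℝ ℝ.* p ℝ.* w ℝ.+ 2ℝ
  x = quartic c ℝ.+ 2ℝ ℝ.* p
  y = quartic a ℝ.+ 2ℝ ℝ.* q
  -- From p(c² + ca + a²) = 1 = q(a² + ab + b²) one gets q − p = pqw.  Hence
  -- 2(q − p) = 2p(p + pqw)w, which exceeds the trapezoidal error p³(c + a) since w ≥ p(c + a).
  step : x ℝ.≤ y ℝ.+ 4ℝ ℝ.* c
  step = ≤-up-to-null x (y ℝ.+ 4ℝ ℝ.* c)
    (null-+ (null-* (e ℝ.* q ℝ.+ 2ℝ ℝ.* (a ℝ.+ c)) (null-cube-step (suc i)))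
            (null-* (fromℤ -1ℤ ℝ.* (e ℝ.* p)) (null-cube-step i)))
    λ n → ≤-from-remainder (remainder≥0 n) (identity (seq a n) (seq b n) (seq c n))
    where
    remainder : ℚ → ℚ → ℚ → ℚ
    remainder a b c = let p = c ℚ.- a; q = a ℚ.- b; w = (p ℚ.+ q) ℚ.* (a ℚ.+ b ℚ.+ c) in
      p ℚ.* p ℚ.* (w ℚ.+ (p ℚ.* b ℚ.+ q ℚ.* (q ℚ.+ q ℚ.+ p ℚ.+ (b ℚ.+ b ℚ.+ b))))
        ℚ.+ 2ℚ ℚ.* (p ℚ.* p ℚ.* q ℚ.* (w ℚ.* w))
    remainder≥0 : ∀ n → 0ℚ ℚ.≤ remainder (seq a n) (seq b n) (seq c n)
    remainder≥0 n = 0≤+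
      (0≤* (0≤* p≥0 p≥0) (0≤+ w≥0 (0≤+ (0≤* p≥0 b≥0)
        (0≤* q≥0 (0≤+ (0≤+ (0≤+ q≥0 q≥0) p≥0) (0≤+ (0≤+ b≥0 b≥0) b≥0))))))
      (0≤* {2ℚ} (ℚ.nonNegative⁻¹ 2ℚ) (0≤* (0≤* (0≤* p≥0 p≥0) q≥0) (0≤* w≥0 w≥0)))
      where
      b≥0 = 0≤∛-seq i n
      p≥0 = 0≤- (∛-seq-≤-suc (suc i) n)
      q≥0 = 0≤- (∛-seq-≤-suc i n)
      w≥0 = 0≤* (0≤+ p≥0 q≥0) (0≤+ (0≤+ (0≤∛-seq (suc i) n) b≥0) (0≤∛-seq (suc (suc i)) n))
    identity : ∀ a b c →
      let p = c ℚ.+ ℚ.- 1ℚ ℚ.* a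
          q = a ℚ.+ ℚ.- 1ℚ ℚ.* b
          w = (c ℚ.+ ℚ.- 1ℚ ℚ.* b) ℚ.* (a ℚ.+ b ℚ.+ c)
          e = 2ℚ ℚ.* p ℚ.* w ℚ.+ 2ℚ
      in ((3ℚ ℚ.* (a ℚ.* a ℚ.* a ℚ.* a) ℚ.+ 2ℚ ℚ.* a) ℚ.+ 2ℚ ℚ.* q) ℚ.+ 4ℚ ℚ.* c
           ℚ.+ ((e ℚ.* q ℚ.+ 2ℚ ℚ.* (a ℚ.+ c)) ℚ.* (c ℚ.* c ℚ.* c ℚ.- a ℚ.* a ℚ.* a ℚ.- 1ℚ)
           ℚ.+ (ℚ.- 1ℚ ℚ.* (e ℚ.* p)) ℚ.* (a ℚ.* a ℚ.* a ℚ.- b ℚ.* b ℚ.* b ℚ.- 1ℚ))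
         ≡ ((3ℚ ℚ.* (c ℚ.* c ℚ.* c ℚ.* c) ℚ.+ 2ℚ ℚ.* c) ℚ.+ 2ℚ ℚ.* p) ℚ.+ remainder a b c
    identity = solve 3 (λ a b c →
      let p = c :+ con (ℚ.- 1ℚ) :* a
          q = a :+ con (ℚ.- 1ℚ) :* b
          w = (c :+ con (ℚ.- 1ℚ) :* b) :* (a :+ b :+ c)
          e = con 2ℚ :* p :* w :+ con 2ℚ
          p′ = c :- a
          q′ = a :- b
          w′ = (p′ :+ q′) :* (a :+ b :+ c)
      in ((con 3ℚ :* (a :* a :* a :* a) :+ con 2ℚ :* a) :+ con 2ℚ :* q) :+ con 4ℚ :* c
           :+ ((e :* q :+ con 2ℚ :* (a :+ c)) :* (c :* c :* c :- a :* a :* a :- con 1ℚ)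
           :+ (con (ℚ.- 1ℚ) :* (e :* p)) :* (a :* a :* a :- b :* b :* b :- con 1ℚ))
         := ((con 3ℚ :* (c :* c :* c :* c) :+ con 2ℚ :* c) :+ con 2ℚ :* p)
           :+ (p′ :* p′ :* (w′ :+ (p′ :* b :+ q′ :* (q′ :+ q′ :+ p′ :+ (b :+ b :+ b))))
             :+ con 2ℚ :* (p′ :* p′ :* q′ :* (w′ :* w′)))) refl
  bound : x ℝ.≤ (4ℝ ℝ.* s ℝ.+ 3ℝ) ℝ.+ 4ℝ ℝ.* c
  bound = ≤-trans x (y ℝ.+ 4ℝ ℝ.* c) ((4ℝ ℝ.* s ℝ.+ 3ℝ) ℝ.+ 4ℝ ℝ.* c)
    step (+-monoˡ-≤ y (4ℝ ℝ.* s ℝ.+ 3ℝ) (4ℝ ℝ.* c) (quartic+2Δ≤4∑+3 i))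

-- The hypotheses say m + ¼ ≤ x ≤ m + ¾.
floor-from-bounds : ∀ x m → 4ℝ ℝ.* x ℝ.+ fromℤ (+ 1) ℝ.≤ fromℤ (+ (4 * suc m)) →
  fromℤ (+ (4 * suc m)) ℝ.≤ 4ℝ ℝ.* x ℝ.+ 3ℝ → ⌊ x ⌋≡ + m
floor-from-bounds x m upper lower = m≤x , x<m+1
  where
  M = + suc m / 1
  4M : + (4 * suc m) / 1 ≡ 4ℚ ℚ.* M
  4M = sym (ℝ./-* 4 (suc m) 0 0)
  ¼ = + 1 / 4
  m≤x : fromℤ (+ m) ℝ.≤ x
  m≤x ε 0<ε = let N , h = lower 1ℚ (ℚ.positive⁻¹ 1ℚ) in N , λ n hn →
    ℚ.≤-trans (subst₂ ℚ._≤_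
      (trans (cong (λ t → ¼ ℚ.* t ℚ.- 1ℚ) (trans 4M (cong (4ℚ ℚ.*_) (sym (ℝ./-+ 1 m 0)))))
        (solve 1 (λ m → con ¼ :* (con 4ℚ :* (con 1ℚ :+ m)) :- con 1ℚ := m) refl (+ m / 1)))
      (solve 1 (λ x → con ¼ :* (con 4ℚ :* x :+ con 3ℚ :+ con 1ℚ) :- con 1ℚ := x) refl (seq x n))
      (ℚ.+-monoˡ-≤ (ℚ.- 1ℚ) (ℚ.*-monoˡ-≤-nonNeg ¼ (h n hn))))
    (ℝ.p≤p+q (seq x n) ε 0<ε)
  x<m+1 : x ℝ.< fromℤ (+ m ℤ.+ + 1)
  x<m+1 = let N , h = upper ½ (ℚ.positive⁻¹ ½) in ⅛ , ℚ.positive⁻¹ ⅛ , N , λ n hn →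
    subst₂ ℚ._≤_
      (solve 1 (λ x → con ¼ :* (con 4ℚ :* x :+ con 1ℚ) :- con ⅛ := x :+ con ⅛) refl (seq x n))
      (trans (cong (λ t → ¼ ℚ.* (t ℚ.+ ½) ℚ.- ⅛) 4M)
        (trans (solve 1 (λ M → con ¼ :* (con 4ℚ :* M :+ con ½) :- con ⅛ := M) refl M)
          (cong (λ t → + t / 1) (ℕ.+-comm 1 m))))
      (ℚ.+-monoˡ-≤ (ℚ.- ⅛) (ℚ.*-monoˡ-≤-nonNeg ¼ (h n hn)))
    where ⅛ = + 1 / 8

⌊∑∛⌋-cube : ∀ k m → 3 * (cube (suc k) * suc k) ℕ.+ 2 * suc k ≡ 4 * suc m →
  ⌊ ∑₁ (cube (suc k)) ∛ ⌋≡ + m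
⌊∑∛⌋-cube k m eq = floor-from-bounds s m
  (≤-trans (4ℝ ℝ.* s ℝ.+ fromℤ (+ 1)) (quartic r) t (4∑+1≤quartic i) (≃⇒≤ (quartic r) t quartic-r))
  (≤-trans t (quartic r) (4ℝ ℝ.* s ℝ.+ 3ℝ) (≃⇒≤ t (quartic r) (≃-sym (quartic r) t quartic-r))
    (≤-trans (quartic r) (quartic r ℝ.+ 2ℝ ℝ.* (r − ∛ i)) (4ℝ ℝ.* s ℝ.+ 3ℝ)
      (≤-pointwise (quartic r) (quartic r ℝ.+ 2ℝ ℝ.* (r − ∛ i)) λ n →
        ≤-from-remainder (0≤* {2ℚ} (ℚ.nonNegative⁻¹ 2ℚ) (0≤- (∛-seq-≤-suc i n)))
          (solve 3 (λ z r b → z :+ con 2ℚ :* (r :+ con (ℚ.- 1ℚ) :* b) := z :+ con 2ℚ :* (r :- b)) refl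
            (seq (quartic r) n) (seq r n) (seq (∛ i) n)))
      (quartic+2Δ≤4∑+3 i)))
  where
  i = ℕ.pred (cube (suc k))
  s = ∑₁ (cube (suc k)) ∛
  r = ∛ (cube (suc k))
  t = fromℤ (+ (4 * suc m))
  quartic-r : quartic r ≃ t
  quartic-r ε 0<ε = let N , h = quartic-cong r (fromℤ (+ suc k)) (∛-of-cube (suc k)) ε 0<ε in N , λ n hn →
    subst (λ u → ∣ seq (quartic r) n ℚ.- u ∣ ℚ.< ε)
      (trans (quartic-fromℤ (suc k) n) (cong (λ u → + u / 1) eq)) (h n hn)

m/1≡[1+m]/1-1 : ∀ m → + m / 1 ≡ + suc m / 1 - 1ℚ
m/1≡[1+m]/1-1 m = trans
  (solve 1 (λ m → m := (con 1ℚ :+ m) :- con 1ℚ) refl (+ m / 1))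
  (cong (_- 1ℚ) (ℝ./-+ 1 m 0))

theorem2 : (n : ℕ) → 1 ≤ n → 3 ∣ n →
    ∃[ m ] (⌊ ∑₁ (10 ^ n) ∛ ⌋≡ m)
    × (m / 1 ≡ (+ (3 * 10 ^ ((4 * n) div 3))) / 4 + (+ (5 * 10 ^ (n div 3 ∸ 1))) / 1 - 1ℚ)
theorem2 .(zero * 3) () (divides zero refl)
theorem2 .(suc j * 3) _ (divides (suc j) refl) = + m ,
  subst (λ N → ⌊ ∑₁ N ∛ ⌋≡ + m) (trans (cong cube suc-k) cube≡)
    (⌊∑∛⌋-cube k m (trans (cong (λ M → 3 * (cube M * M) ℕ.+ 2 * M) suc-k)
      (trans (quartic-10* P) (cong (4 *_) (sym suc-m))))) ,
  (begin
    + m / 1                                          ≡⟨ m/1≡[1+m]/1-1 m ⟩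
    + suc m / 1 - 1ℚ                                 ≡⟨ cong (λ t → + t / 1 - 1ℚ) suc-m ⟩
    + (A ℕ.+ 5 * P) / 1 - 1ℚ                         ≡⟨ cong (_- 1ℚ) (sym (ℝ./-+ A (5 * P) 0)) ⟩
    + A / 1 + + (5 * P) / 1 - 1ℚ                     ≡⟨ cong (λ t → t + + (5 * P) / 1 - 1ℚ) A≡ ⟩
    + (3 * 10 ^ ((4 * n) div 3)) / 4 + + (5 * P) / 1 - 1ℚ
      ≡⟨ cong (λ t → + (3 * 10 ^ ((4 * n) div 3)) / 4 + + (5 * 10 ^ (t ∸ 1)) / 1 - 1ℚ)
           (sym (ℕ.m*n/n≡m (suc j) 3)) ⟩
    + (3 * 10 ^ ((4 * n) div 3)) / 4 + + (5 * 10 ^ (n div 3 ∸ 1)) / 1 - 1ℚ ∎)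
  where
  open ≡-Reasoning
  n = suc j * 3
  P = 10 ^ j
  A = 7500 * (cube P * P)
  k = ℕ.pred (10 * P)
  m = ℕ.pred (A ℕ.+ 5 * P)
  instance
    P≢0 : ℕ.NonZero P
    P≢0 = ℕ.m^n≢0 10 j
  suc-k : suc k ≡ 10 * P
  suc-k = ℕ.suc-pred (10 * P) {{ℕ.m*n≢0 10 P}}
  suc-m : suc m ≡ A ℕ.+ 5 * P
  suc-m = ℕ.suc-pred (A ℕ.+ 5 * P)
    {{ℕ.>-nonZero (ℕ.<-≤-trans (ℕ.>-nonZero⁻¹ (5 * P) {{ℕ.m*n≢0 5 P}}) (ℕ.m≤n+m (5 * P) A))}}
  cube≡ : cube (10 * P) ≡ 10 ^ n
  cube≡ = trans (x*x*x≡x^3 (10 ^ suc j)) (ℕ.^-*-assoc 10 (suc j) 3)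
    where
    x*x*x≡x^3 : ∀ x → x * x * x ≡ x * (x * (x * 1))
    x*x*x≡x^3 = solve-∀
  quartic-10* : ∀ x → 3 * (10 * x * (10 * x) * (10 * x) * (10 * x)) ℕ.+ 2 * (10 * x)
                      ≡ 4 * (7500 * (x * x * x * x) ℕ.+ 5 * x)
  quartic-10* = solve-∀
  exponent : (4 * n) div 3 ≡ suc j * 4
  exponent = trans (cong (_div 3) (trans (sym (ℕ.*-assoc 4 (suc j) 3)) (cong (_* 3) (ℕ.*-comm 4 (suc j)))))
    (ℕ.m*n/n≡m (suc j * 4) 3)
  A≡ : + A / 1 ≡ + (3 * 10 ^ ((4 * n) div 3)) / 4
  A≡ = ℝ./-cong {A} {3 * 10 ^ ((4 * n) div 3)} {0} {3} (begin
    A * 4                          ≡⟨ regroup P ⟩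
    3 * ((10 * P) ^ 4) * 1         ≡⟨ cong (λ t → 3 * t * 1) (ℕ.^-*-assoc 10 (suc j) 4) ⟩
    3 * 10 ^ (suc j * 4) * 1       ≡⟨ cong (λ t → 3 * 10 ^ t * 1) (sym exponent) ⟩
    3 * 10 ^ ((4 * n) div 3) * 1   ∎)
    where
    regroup : ∀ x → 7500 * (x * x * x * x) * 4 ≡ 3 * (10 * x * (10 * x * (10 * x * (10 * x * 1)))) * 1
    regroup = solve-∀
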